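{- Every GaTEx graph is murky, i.e., the graph and its complement both contain no hole and no induced path $P_6$ on six vertices.
   Context: All graphs are finite, simple and undirected. A galled-tree on a finite nonempty set $X$ is a directed acyclic graph $N=(V,E)$ such that either $V=X=\{x\}$ and $E=\emptyset$, or: (N1) there is a unique root with indegree 0 and outdegree at least 2; (N2) $x\in X$ iff $x$ has outdegree 0 and indegree 1; (N3) every non-root $v\in V\setminus X$ has either indegree 1 and outdegree at least 2, or indegree 2 and outdegree at least 1 (hybrid-vertex); (N4) each biconnected component $C$ of $N$ contains at most one hybrid-vertex whose two in-neighbours both belong to $C$. For $x,y\in X$, $\mathrm{lca}_N(x,y)$ is the (unique) minimal common ancestor of $x,y$. A labeled galled-tree $(N,t)$ has $t:V\to\{0,1,\odot\}$ with $t(x)=\odot$ iff $x\in X$; it explains the graph on $X$ where $\{x,y\}$ is an edge iff $t(\mathrm{lca}_N(x,y))=1$. A graph is GaTEx if it is isomorphic to a graph explained by some labeled galled-tree. A hole is an induced cycle on at least five vertices. -}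

module Defs where

open import Data.Nat using (ℕ; zero; suc; _+_; _≤_)
open import Data.Fin using (Fin; zero; suc; toℕ; _≟_)
open import Data.Bool using (Bool; true; false; if_then_else_; not; _∧_)
open import Data.Product using (Σ; ∃; _×_; _,_)
open import Data.Sum using (_⊎_)
open import Relation.Nullary using (¬_)
open import Relation.Nullary.Decidable using (⌊_⌋)
open import Relation.Binary.PropositionalEquality using (_≡_; _≢_)
open import Function.Definitions using (Injective)
open import Function.Bundles using (_⇔_)

record SimpleGraph (n : ℕ) : Set where
  field
    adj    : Fin n → Fin n → Bool
    sym    : ∀ x y → adj x y ≡ adj y x
    irrefl : ∀ x → adj x x ≡ false

complementAdj : ∀ {n} → (Fin n → Fin n → Bool) → Fin n → Fin n → Bool
complementAdj a x y = not (a x y) ∧ not ⌊ x ≟ y ⌋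

PathAdj : ∀ {k} → Fin k → Fin k → Set
PathAdj i j = (suc (toℕ i) ≡ toℕ j) ⊎ (suc (toℕ j) ≡ toℕ i)

CycleAdj : ∀ {k} → Fin k → Fin k → Set
CycleAdj {k} i j = PathAdj i j
                 ⊎ ((toℕ i ≡ 0 × suc (toℕ j) ≡ k) ⊎ (toℕ j ≡ 0 × suc (toℕ i) ≡ k))

InducedCopy : ∀ {n} (k : ℕ) (R : Fin k → Fin k → Set) → (Fin n → Fin n → Bool) → Set
InducedCopy k R a =
  Σ (Fin k → Fin _) λ f → Injective _≡_ _≡_ f × (∀ i j → (a (f i) (f j) ≡ true) ⇔ R i j)

HasHole : ∀ {n} → (Fin n → Fin n → Bool) → Set
HasHole a = Σ ℕ λ k → 5 ≤ k × InducedCopy k CycleAdj a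

HasP6 : ∀ {n} → (Fin n → Fin n → Bool) → Set
HasP6 a = InducedCopy 6 PathAdj a

Murky : ∀ {n} → SimpleGraph n → Set
Murky G = ¬ HasHole a × ¬ HasP6 a × ¬ HasHole (complementAdj a) × ¬ HasP6 (complementAdj a)
  where a = SimpleGraph.adj G

count : ∀ {m} → (Fin m → Bool) → ℕ
count {zero}  p = 0
count {suc m} p = (if p zero then 1 else 0) + count (λ i → p (suc i))

module _ {m : ℕ} (E : Fin m → Fin m → Bool) where

  indeg : Fin m → ℕ
  indeg v = count (λ u → E u v)

  outdeg : Fin m → ℕ
  outdeg v = count (λ w → E v w)

  data Reach : Fin m → Fin m → Set where
    here : ∀ {u} → Reach u u
    step : ∀ {u w v} → E u w ≡ true → Reach w v → Reach u v

  Acyclic : Set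
  Acyclic = ∀ u v → E u v ≡ true → ¬ Reach v u

  data UReach (S : Fin m → Bool) : Fin m → Fin m → Set where
    here : ∀ {u} → S u ≡ true → UReach S u u
    step : ∀ {u w v} → (E u w ≡ true ⊎ E w u ≡ true) → S u ≡ true
         → UReach S w v → UReach S u v

  ConnectedOn : (Fin m → Bool) → Set
  ConnectedOn S = ∀ u v → S u ≡ true → S v ≡ true → UReach S u v

  removeV : Fin m → (Fin m → Bool) → Fin m → Bool
  removeV z S w = S w ∧ not ⌊ w ≟ z ⌋

  Biconnected : (Fin m → Bool) → Set
  Biconnected S = ConnectedOn S × (∀ z → S z ≡ true → ConnectedOn (removeV z S))

  IsBlock : (Fin m → Bool) → Set
  IsBlock S = Biconnected S
            × (∀ S' → (∀ w → S w ≡ true → S' w ≡ true) → Biconnected S'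
                    → ∀ w → S' w ≡ true → S w ≡ true)

  IsLeaf : Fin m → Set
  IsLeaf v = outdeg v ≡ 0 × indeg v ≡ 1

  HybridIn : (Fin m → Bool) → Fin m → Set
  HybridIn S h = indeg h ≡ 2 × S h ≡ true × (∀ u → E u h ≡ true → S u ≡ true)

  TrivialGT : Set
  TrivialGT = m ≡ 1 × (∀ u v → E u v ≡ false)

  -- conditions (N1)-(N4) for a DAG (X = leaves, (N2))
  NontrivialGT : Set
  NontrivialGT =
      Acyclic
    × (Σ (Fin m) λ r →
         (indeg r ≡ 0 × 2 ≤ outdeg r × (∀ v → indeg v ≡ 0 → v ≡ r))
       × (∀ v → v ≢ r → ¬ IsLeaf v →
            (indeg v ≡ 1 × 2 ≤ outdeg v) ⊎ (indeg v ≡ 2 × 1 ≤ outdeg v)))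
    × (∀ S → IsBlock S → ∀ h h' → HybridIn S h → HybridIn S h' → h ≡ h')

  IsGalledTree : Set
  IsGalledTree = TrivialGT ⊎ NontrivialGT

  InX : Fin m → Set
  InX v = TrivialGT ⊎ IsLeaf v

  IsLCA : Fin m → Fin m → Fin m → Set
  IsLCA a b v = Reach v a × Reach v b
              × (∀ w → Reach w a → Reach w b → Reach v w → w ≡ v)

data Label : Set where
  lab0 lab1 odot : Label

-- G is GaTEx: G is isomorphic (via ι : Fin n → X) to the graph explained
-- by a labeled galled-tree (E, t) on vertex set Fin m.
GaTEx : ∀ {n} → SimpleGraph n → Set
GaTEx {n} G =
  Σ ℕ λ m → Σ (Fin m → Fin m → Bool) λ E → Σ (Fin m → Label) λ t → Σ (Fin n → Fin m) λ ι →
      IsGalledTree E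
    × (∀ v → (t v ≡ odot) ⇔ InX E v)
    × Injective _≡_ _≡_ ι
    × (∀ v → InX E v ⇔ (∃ λ x → ι x ≡ v))
    × (∀ x y → x ≢ y → ∀ v → IsLCA E (ι x) (ι y) v →
         (SimpleGraph.adj G x y ≡ true) ⇔ (t v ≡ lab1))

{-# OPTIONS --safe #-}
module Submission where

-- If v is the immediate dominator of h, the vertices between v and h form a
-- biconnected set; hence by (N4) distinct hybrids have intervals sharing at most one
-- vertex. Given leaves inducing a connected and co-connected graph, let v be a lowest
-- vertex above all of them. Two children of v have a common leaf below them, which
-- lies below a hybrid h immediately dominated by v. The leaves below h form a module,
-- those on one side of the gall relate uniformly to all leaves beyond, and no
-- induced P₄ lies below one side and straddles h, since its own gall would have to be
-- the same. No C₅, C₆ or P₆ admits such a partition, longer holes contain P₆, and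
-- exchanging the labels 0 and 1 complements the graph.

open import Defs
open import Data.Nat using (ℕ; zero; suc; _≤_; _<_; z≤n; s≤s)
import Data.Nat.Properties as ℕ
open import Data.Nat.Induction using (<-wellFounded)
open import Data.Fin using (Fin; zero; suc; toℕ; inject₁; inject≤; _≟_)
open import Data.Fin.Induction using (po-wellFounded; po-noetherian)
open import Data.Fin.Properties using (any?; all?; ¬∀⟶∃¬; inject≤-injective; toℕ-inject≤; toℕ<n)
open import Data.Bool using (Bool; true; false; not; _∧_; _∨_; if_then_else_)
import Data.Bool.Properties as Bool
open import Data.Vec using (Vec; []; _∷_; lookup; tabulate)
open import Data.Vec.Properties using (lookup∘tabulate)
open import Data.Empty using (⊥; ⊥-elim)
open import Data.Product using (∃; ∃₂; _×_; _,_; proj₁; proj₂)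
open import Data.Sum using (_⊎_; inj₁; inj₂; [_,_]′)
open import Function using (_∘_; flip)
open import Function.Bundles using (_⇔_; Equivalence; mk⇔)
open import Induction.WellFounded using (Acc; acc)
open import Relation.Nullary using (¬_; Dec; yes; no; contradiction; ¬?; _×-dec_; _⊎-dec_; _→-dec_)
open import Relation.Nullary.Decidable using (⌊_⌋; map′; decidable-stable; toWitness)
open import Relation.Unary using (Decidable)
open import Relation.Binary.Structures using (IsPartialOrder)
open import Relation.Binary.PropositionalEquality
  using (_≡_; _≢_; refl; sym; trans; cong; subst; subst₂; isEquivalence; ≢-sym)

-- Booleans and decided propositions

true? : (b : Bool) → Dec (b ≡ true)
true? = Bool._≟ true

≢true⇒false : ∀ {b} → b ≢ true → b ≡ false
≢true⇒false = Bool.¬-not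

holds⇒true : ∀ {P : Set} (d : Dec P) → P → ⌊ d ⌋ ≡ true
holds⇒true (yes _) _ = refl
holds⇒true (no ¬p) p = ⊥-elim (¬p p)

true⇒holds : ∀ {P : Set} (d : Dec P) → ⌊ d ⌋ ≡ true → P
true⇒holds (yes p) _ = p

fails⇒false : ∀ {P : Set} (d : Dec P) → ¬ P → ⌊ d ⌋ ≡ false
fails⇒false d ¬p = ≢true⇒false (¬p ∘ true⇒holds d)

∧-true : ∀ {x y} → x ≡ true → y ≡ true → x ∧ y ≡ true
∧-true refl refl = refl

∧-true⁻ : ∀ x {y} → x ∧ y ≡ true → x ≡ true × y ≡ true
∧-true⁻ true e = refl , e

∨-trueˡ : ∀ {x} y → x ≡ true → x ∨ y ≡ true
∨-trueˡ _ refl = refl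

∨-trueʳ : ∀ x {y} → y ≡ true → x ∨ y ≡ true
∨-trueʳ x refl = Bool.∨-zeroʳ x

∨-true⁻ : ∀ x {y} → x ∨ y ≡ true → x ≡ true ⊎ y ≡ true
∨-true⁻ true  e = inj₁ refl
∨-true⁻ false e = inj₂ e

-- Counting

indicator-mono : ∀ {x y} → (x ≡ true → y ≡ true) → (if x then 1 else 0) ≤ (if y then 1 else 0)
indicator-mono {false}     _ = z≤n
indicator-mono {true} {y} i = subst (λ b → 1 ≤ (if b then 1 else 0)) (sym (i refl)) (s≤s z≤n)

count-mono : ∀ {m} {p q : Fin m → Bool} → (∀ i → p i ≡ true → q i ≡ true) → count p ≤ count q
count-mono {zero}  p⊆q = z≤n
count-mono {suc m} p⊆q = ℕ.+-mono-≤ (indicator-mono (p⊆q zero)) (count-mono (p⊆q ∘ suc))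

count-strict : ∀ {m} {p q : Fin m → Bool} → (∀ i → p i ≡ true → q i ≡ true) →
               ∀ w → p w ≡ false → q w ≡ true → count p < count q
count-strict p⊆q zero pw qw rewrite pw | qw = s≤s (count-mono (p⊆q ∘ suc))
count-strict p⊆q (suc w) pw qw =
  ℕ.+-mono-≤-< (indicator-mono (p⊆q zero)) (count-strict (p⊆q ∘ suc) w pw qw)

count-none : ∀ {m} {p : Fin m → Bool} → (∀ i → p i ≡ false) → count p ≡ 0
count-none {zero}  _ = refl
count-none {suc m} none rewrite none zero = count-none (none ∘ suc)

count≢0⇒∃ : ∀ {m} {p : Fin m → Bool} → count p ≢ 0 → ∃ λ i → p i ≡ true
count≢0⇒∃ {p = p} ≢0 with any? (true? ∘ p)
... | yes found = found
... | no  none  = contradiction (count-none (λ i → ≢true⇒false (λ e → none (i , e)))) ≢0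

count-one : ∀ {m} {p : Fin m → Bool} {i} → p i ≡ true → 1 ≤ count p
count-one {i = i} pi = ℕ.≤-<-trans z≤n (count-strict {p = λ _ → false} (λ _ ()) i refl pi)

module _ {m : ℕ} {p : Fin m → Bool} where

  count-two : ∀ {i j} → i ≢ j → p i ≡ true → p j ≡ true → 2 ≤ count p
  count-two {i} {j} i≢j pi pj = ℕ.≤-<-trans
    (count-one {p = λ l → ⌊ l ≟ i ⌋} (holds⇒true (i ≟ i) refl))
    (count-strict (λ l e → subst (λ l → p l ≡ true) (sym (true⇒holds (l ≟ i) e)) pi)
      j (fails⇒false (j ≟ i) (≢-sym i≢j)) pj)

module _ {m : ℕ} {p : Fin m → Bool} where

  count-three : ∀ {i j k} → i ≢ j → i ≢ k → j ≢ k →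
                p i ≡ true → p j ≡ true → p k ≡ true → 3 ≤ count p
  count-three {i} {j} {k} i≢j i≢k j≢k pi pj pk = ℕ.≤-<-trans
    (count-two {p = pair} i≢j (∨-trueˡ _ (holds⇒true (i ≟ i) refl))
                              (∨-trueʳ ⌊ j ≟ i ⌋ (holds⇒true (j ≟ j) refl)))
    (count-strict pair⊆p k k∉pair pk)
    where
    pair : Fin m → Bool
    pair l = ⌊ l ≟ i ⌋ ∨ ⌊ l ≟ j ⌋

    pair⁻ : ∀ l → pair l ≡ true → l ≡ i ⊎ l ≡ j
    pair⁻ l e with ∨-true⁻ ⌊ l ≟ i ⌋ e
    ... | inj₁ e = inj₁ (true⇒holds (l ≟ i) e)
    ... | inj₂ e = inj₂ (true⇒holds (l ≟ j) e)

    pair⊆p : ∀ l → pair l ≡ true → p l ≡ true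
    pair⊆p l e with pair⁻ l e
    ... | inj₁ refl = pi
    ... | inj₂ refl = pj

    k∉pair : pair k ≡ false
    k∉pair = ≢true⇒false ([ i≢k ∘ sym , j≢k ∘ sym ]′ ∘ pair⁻ k)

-- Biconnected sets

module Connectivity {m : ℕ} (E : Fin m → Fin m → Bool) where

  removeV⁺ : ∀ {z w} {S : Fin m → Bool} → S w ≡ true → w ≢ z → removeV E z S w ≡ true
  removeV⁺ {z} {w} Sw w≢z = ∧-true Sw (cong not (fails⇒false (w ≟ z) w≢z))

  removeV⁻ : ∀ {z w} {S : Fin m → Bool} → removeV E z S w ≡ true → S w ≡ true × w ≢ z
  removeV⁻ {z} {w} {S} e with ∧-true⁻ (S w) e
  ... | Sw , w∉z = Sw , λ w≡z → contradiction (trans (sym w∉z) (cong not (holds⇒true (w ≟ z) w≡z))) λ ()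

  module _ {S : Fin m → Bool} where

    UReach-start : ∀ {u v} → UReach E S u v → S u ≡ true
    UReach-start (here Su)     = Su
    UReach-start (step _ Su _) = Su

    UReach-trans : ∀ {u v w} → UReach E S u v → UReach E S v w → UReach E S u w
    UReach-trans (here _)      q = q
    UReach-trans (step e Su p) q = step e Su (UReach-trans p q)

    UReach-edge : ∀ {u v} → E u v ≡ true → S u ≡ true → S v ≡ true → UReach E S u v
    UReach-edge e Su Sv = step (inj₁ e) Su (here Sv)

    UReach-sym : ∀ {u v} → UReach E S u v → UReach E S v u
    UReach-sym (here Su)            = here Su
    UReach-sym (step (inj₁ e) Su p) =
      UReach-trans (UReach-sym p) (step (inj₂ e) (UReach-start p) (here Su))
    UReach-sym (step (inj₂ e) Su p) =
      UReach-trans (UReach-sym p) (step (inj₁ e) (UReach-start p) (here Su))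

    connected-via : ∀ h → (∀ u → S u ≡ true → UReach E S u h) → ConnectedOn E S
    connected-via h to-h u v Su Sv = UReach-trans (to-h u Su) (UReach-sym (to-h v Sv))

  UReach-mono : ∀ {S T : Fin m → Bool} → (∀ w → S w ≡ true → T w ≡ true) →
                ∀ {u v} → UReach E S u v → UReach E T u v
  UReach-mono S⊆T (here Su)     = here (S⊆T _ Su)
  UReach-mono S⊆T (step e Su p) = step e (S⊆T _ Su) (UReach-mono S⊆T p)

  -- `Biconnected` speaks only of vertices inside the set. In a union the removed vertex may lie
  -- outside one of the two sets, and that set then stays intact.
  removeV-connected : ∀ {S} → Biconnected E S → ∀ z → ConnectedOn E (removeV E z S)
  removeV-connected {S} (conn , conn-z) z with true? (S z)
  ... | yes Sz = conn-z z Sz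
  ... | no ¬Sz = λ u v u∈ v∈ →
    UReach-mono (λ w Sw → removeV⁺ {S = S} Sw (λ { refl → ¬Sz Sw }))
                (conn u v (proj₁ (removeV⁻ {S = S} u∈)) (proj₁ (removeV⁻ {S = S} v∈)))

  _∪_ : (S T : Fin m → Bool) → Fin m → Bool
  (S ∪ T) w = S w ∨ T w

  -- Whichever vertex is removed, `a` or `b` survives, and all that remains of either set is still
  -- joined to the survivor.
  ∪-biconnected : ∀ {S T a b} → Biconnected E S → Biconnected E T → a ≢ b →
                  S a ≡ true → T a ≡ true → S b ≡ true → T b ≡ true → Biconnected E (S ∪ T)
  ∪-biconnected {S} {T} {a} {b} bS bT a≢b Sa Ta Sb Tb = connected , λ z _ → connected-without z
    where
    connected : ConnectedOn E (S ∪ T)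
    connected = connected-via a to-a
      where
      to-a : ∀ u → (S ∪ T) u ≡ true → UReach E (S ∪ T) u a
      to-a u u∈ with ∨-true⁻ (S u) u∈
      ... | inj₁ Su = UReach-mono (λ w → ∨-trueˡ (T w)) (proj₁ bS u a Su Sa)
      ... | inj₂ Tu = UReach-mono (λ w → ∨-trueʳ (S w)) (proj₁ bT u a Tu Ta)

    connected-without-via : ∀ z c → c ≢ z → S c ≡ true → T c ≡ true →
                            ConnectedOn E (removeV E z (S ∪ T))
    connected-without-via z c c≢z Sc Tc = connected-via c to-c
      where
      to-c : ∀ u → removeV E z (S ∪ T) u ≡ true → UReach E (removeV E z (S ∪ T)) u c
      to-c u u∈ with removeV⁻ {S = S ∪ T} u∈
      ... | Uu , u≢z with ∨-true⁻ (S u) Uu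
      ... | inj₁ Su = UReach-mono
        (λ w w∈ → let Sw , w≢z = removeV⁻ {S = S} w∈ in removeV⁺ {S = S ∪ T} (∨-trueˡ (T w) Sw) w≢z)
        (removeV-connected bS z u c (removeV⁺ {S = S} Su u≢z) (removeV⁺ {S = S} Sc c≢z))
      ... | inj₂ Tu = UReach-mono
        (λ w w∈ → let Tw , w≢z = removeV⁻ {S = T} w∈ in removeV⁺ {S = S ∪ T} (∨-trueʳ (S w) Tw) w≢z)
        (removeV-connected bT z u c (removeV⁺ {S = T} Tu u≢z) (removeV⁺ {S = T} Tc c≢z))

    connected-without : ∀ z → ConnectedOn E (removeV E z (S ∪ T))
    connected-without z with a ≟ z
    ... | no a≢z   = connected-without-via z a a≢z Sa Ta
    ... | yes refl = connected-without-via z b (≢-sym a≢b) Sb Tb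

  HybridIn-mono : ∀ {S T : Fin m → Bool} → (∀ w → S w ≡ true → T w ≡ true) →
                  ∀ {h} → HybridIn E S h → HybridIn E T h
  HybridIn-mono S⊆T (two , Sh , parents) = two , S⊆T _ Sh , λ u e → S⊆T u (parents u e)

  -- A set violating this with the most vertices would be a block.
  biconnected-hybrid-unique :
    (∀ S → IsBlock E S → ∀ h h′ → HybridIn E S h → HybridIn E S h′ → h ≡ h′) →
    ∀ S → Biconnected E S → ∀ {h h′} → HybridIn E S h → HybridIn E S h′ → h ≡ h′
  biconnected-hybrid-unique block-unique S bS {h} {h′} = go S (<-wellFounded _) bS
    where
    go : ∀ S → Acc _<_ (count (not ∘ S)) → Biconnected E S →
         HybridIn E S h → HybridIn E S h′ → h ≡ h′
    go S (acc rec) bS hS h′S with h ≟ h′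
    ... | yes h≡h′ = h≡h′
    ... | no  h≢h′ = block-unique S (bS , maximal) h h′ hS h′S
      where
      maximal : ∀ T → (∀ w → S w ≡ true → T w ≡ true) → Biconnected E T →
                ∀ w → T w ≡ true → S w ≡ true
      maximal T S⊆T bT w Tw with true? (S w)
      ... | yes Sw = Sw
      ... | no ¬Sw = contradiction
        (go T (rec fewer-missing) bT (HybridIn-mono S⊆T hS) (HybridIn-mono S⊆T h′S)) h≢h′
        where
        antitone : ∀ v → not (T v) ≡ true → not (S v) ≡ true
        antitone v e = cong not (≢true⇒false λ Sv →
          contradiction (trans (sym e) (cong not (S⊆T v Sv))) λ ())

        fewer-missing : count (not ∘ T) < count (not ∘ S)
        fewer-missing = count-strict antitone w (cong not Tw) (cong not (≢true⇒false ¬Sw))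

-- Dominators in a galled-tree

module GalledTree {m : ℕ} (E : Fin m → Fin m → Bool) (N : NontrivialGT E) where

  open Connectivity E

  -- Reachability as a finite partial order

  infix 4 _⟶_ _⇝_

  _⟶_ : Fin m → Fin m → Set
  u ⟶ v = E u v ≡ true

  _⇝_ : Fin m → Fin m → Set
  _⇝_ = Reach E

  Hybrid : Fin m → Set
  Hybrid h = indeg E h ≡ 2

  acyclic : Acyclic E
  acyclic = proj₁ N

  root : Fin m
  root = proj₁ (proj₁ (proj₂ N))

  root-indeg : indeg E root ≡ 0
  root-indeg = proj₁ (proj₁ (proj₂ (proj₁ (proj₂ N))))

  root-unique : ∀ v → indeg E v ≡ 0 → v ≡ root
  root-unique = proj₂ (proj₂ (proj₁ (proj₂ (proj₁ (proj₂ N)))))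

  ⇝-trans : ∀ {u v w} → u ⇝ v → v ⇝ w → u ⇝ w
  ⇝-trans here       q = q
  ⇝-trans (step e p) q = step e (⇝-trans p q)

  edge : ∀ {u v} → u ⟶ v → u ⇝ v
  edge e = step e here

  ⇝-antisym : ∀ {u v} → u ⇝ v → v ⇝ u → u ≡ v
  ⇝-antisym here       q = refl
  ⇝-antisym (step e p) q = contradiction (⇝-trans p q) (acyclic _ _ e)

  ⟶⇒≢ : ∀ {u v} → u ⟶ v → u ≢ v
  ⟶⇒≢ e refl = acyclic _ _ e here

  -- Finiteness makes this order well-founded both ways, for recursion down the edges in `_⇝?_` and
  -- `lowest` and up the edges in `root-reaches`.
  ⇝-isPartialOrder : IsPartialOrder _≡_ _⇝_
  ⇝-isPartialOrder = record
    { isPreorder = record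
      { isEquivalence = isEquivalence
      ; reflexive     = λ { refl → here }
      ; trans         = ⇝-trans
      }
    ; antisym = ⇝-antisym
    }

  reach-≢ : ∀ {c c′ x} → c′ ⇝ x → ¬ c ⇝ x → c ≢ c′
  reach-≢ p ¬p refl = ¬p p

  first-edge : ∀ {u v} → u ⇝ v → u ≢ v → ∃ λ c → u ⟶ c × c ⇝ v
  first-edge here       u≢v = contradiction refl u≢v
  first-edge (step e p) _   = _ , e , p

  last-edge : ∀ {u v} → u ⇝ v → u ≢ v → ∃ λ p → u ⇝ p × p ⟶ v
  last-edge here u≢v = contradiction refl u≢v
  last-edge {v = v} (step {w = w} e p) _ with w ≟ v
  ... | yes refl = _ , here , e
  ... | no  w≢v  = let q , p′ , e′ = last-edge p w≢v in q , step e p′ , e′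

  infix 4 _⇝?_

  _⇝?_ : ∀ u v → Dec (u ⇝ v)
  u ⇝? v = go u (po-noetherian ⇝-isPartialOrder u)
    where
    go : ∀ u → Acc (flip (λ x y → x ⇝ y × x ≢ y)) u → Dec (u ⇝ v)
    go u (acc rec) with u ≟ v
    ... | yes refl = yes here
    ... | no  u≢v  = map′ (λ { (w , e , p) → step e p }) (λ p → first-edge p u≢v)
                          (any? via)
      where
      via : ∀ w → Dec (u ⟶ w × w ⇝ v)
      via w with true? (E u w)
      ... | no ¬e = no (¬e ∘ proj₁)
      ... | yes e = map′ (e ,_) proj₂ (go w (rec (edge e , ⟶⇒≢ e)))

  lowest : ∀ {P : Fin m → Set} → Decidable P → ∀ {u} → P u →
           ∃ λ v → u ⇝ v × P v × (∀ {w} → v ⇝ w → P w → w ≡ v)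
  lowest {P} P? {u} = go u (po-noetherian ⇝-isPartialOrder u)
    where
    go : ∀ u → Acc (flip (λ x y → x ⇝ y × x ≢ y)) u → P u →
         ∃ λ v → u ⇝ v × P v × (∀ {w} → v ⇝ w → P w → w ≡ v)
    go u (acc rec) Pu with any? (λ w → (u ⇝? w) ×-dec ¬? (u ≟ w) ×-dec P? w)
    ... | yes (w , u⇝w , u≢w , Pw) =
      let v , w⇝v , rest = go w (rec (u⇝w , u≢w)) Pw in v , ⇝-trans u⇝w w⇝v , rest
    ... | no none = u , here , Pu , λ {w} u⇝w Pw →
      sym (decidable-stable (u ≟ w) λ u≢w → none (w , u⇝w , u≢w , Pw))

  root-reaches : ∀ v → root ⇝ v
  root-reaches v = go v (po-wellFounded ⇝-isPartialOrder v)
    where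
    go : ∀ v → Acc (λ x y → x ⇝ y × x ≢ y) v → root ⇝ v
    go v (acc rec) with v ≟ root
    ... | yes refl  = here
    ... | no v≢root =
      let p , e = count≢0⇒∃ (v≢root ∘ root-unique v)
      in ⇝-trans (go p (rec (edge e , ⟶⇒≢ e))) (edge e)

  -- Two parents exclude the root and the leaves, and (N3) then leaves only indegree 2; later this
  -- bound refutes a third parent.
  two-parents⇒hybrid : ∀ {p q v} → p ≢ q → p ⟶ v → q ⟶ v → Hybrid v
  two-parents⇒hybrid {v = v} p≢q e e′ = degree v≢root ¬leaf
    where
    2≤indeg : 2 ≤ indeg E v
    2≤indeg = count-two p≢q e e′

    v≢root : v ≢ root
    v≢root refl = contradiction (subst (2 ≤_) root-indeg 2≤indeg) λ ()

    ¬leaf : ¬ IsLeaf E v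
    ¬leaf (_ , one) = contradiction (subst (2 ≤_) one 2≤indeg) λ { (s≤s ()) }

    degree : v ≢ root → ¬ IsLeaf E v → Hybrid v
    degree v≢root ¬leaf with proj₂ (proj₂ (proj₁ (proj₂ N))) v v≢root ¬leaf
    ... | inj₁ (one , _) = contradiction (subst (2 ≤_) one 2≤indeg) λ { (s≤s ()) }
    ... | inj₂ (two , _) = two

  hybrid≢root : ∀ {h} → Hybrid h → root ≢ h
  hybrid≢root two refl = contradiction (trans (sym root-indeg) two) λ ()

  -- An edge p ⟶ g through which h can be reached without passing v.
  Bypass : Fin m → Fin m → Set
  Bypass v h = ∃₂ λ g p → v ⇝ g × g ⇝ h × v ≢ g × p ⟶ g × ¬ v ⇝ p

  bypass? : ∀ v h → Dec (Bypass v h)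
  bypass? v h = any? λ g → any? λ p →
    (v ⇝? g) ×-dec (g ⇝? h) ×-dec ¬? (v ≟ g) ×-dec true? (E p g) ×-dec ¬? (v ⇝? p)

  -- Equivalent to every path from the root to `h` passing through `v`: a path avoiding `v` would
  -- enter the strict descendants of `v` by a bypass edge.
  Dominates : Fin m → Fin m → Set
  Dominates v h = v ⇝ h × v ≢ h × ¬ Bypass v h

  record ImmediatelyDominates (v h : Fin m) : Set where
    field
      dominates : Dominates v h
      lowest-dominator : ∀ {z} → v ⇝ z → Dominates z h → z ≡ v

    reaches : v ⇝ h
    reaches = proj₁ dominates

    distinct : v ≢ h
    distinct = proj₁ (proj₂ dominates)

    parent-below : ∀ {g p} → v ⇝ g → g ⇝ h → v ≢ g → p ⟶ g → v ⇝ p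
    parent-below v⇝g g⇝h v≢g e =
      decidable-stable (v ⇝? _) λ ¬v⇝p → proj₂ (proj₂ dominates) (_ , _ , v⇝g , g⇝h , v≢g , e , ¬v⇝p)

    -- Climb from `h` back to `u`: by `parent-below` the path stays below `v` until it meets `v`,
    -- and from there on it is above `v`.
    comparable : ∀ {u} → u ⇝ h → u ⇝ v ⊎ v ⇝ u
    comparable = go reaches here
      where
      go : ∀ {u w} → v ⇝ w → w ⇝ h → u ⇝ w → u ⇝ v ⊎ v ⇝ u
      go v⇝w w⇝h here = inj₂ v⇝w
      go v⇝w w⇝h (step {w = c} e p) with go v⇝w w⇝h p
      ... | inj₁ c⇝v = inj₁ (step e c⇝v)
      ... | inj₂ v⇝c with v ≟ c
      ... | yes refl = inj₁ (edge e)
      ... | no  v≢c  = inj₂ (parent-below v⇝c (⇝-trans p w⇝h) v≢c e)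

    bypass : ∀ {z} → v ⇝ z → z ⇝ h → v ≢ z → z ≢ h → Bypass z h
    bypass {z} v⇝z z⇝h v≢z z≢h = decidable-stable (bypass? z h) λ none →
      v≢z (sym (lowest-dominator v⇝z (z⇝h , z≢h , none)))

  open ImmediatelyDominates

  -- The root reaches every vertex, so no edge bypasses it and it dominates every hybrid; descend
  -- from it.
  immediate-dominator : ∀ {h} → Hybrid h → ∃ λ v → ImmediatelyDominates v h
  immediate-dominator {h} two =
    let v , _ , dom , low = lowest
          {P = λ v → Dominates v h}
          (λ v → (v ⇝? h) ×-dec ¬? (v ≟ h) ×-dec ¬? (bypass? v h))
          (root-reaches h , hybrid≢root two , λ { (_ , p , _ , _ , _ , _ , ¬r) → ¬r (root-reaches p) })
    in v , record { dominates = dom ; lowest-dominator = low }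

  immediate-dominator-unique : ∀ {v v′ h} → ImmediatelyDominates v h → ImmediatelyDominates v′ h → v ≡ v′
  immediate-dominator-unique d d′ with comparable d (reaches d′)
  ... | inj₁ v′⇝v = lowest-dominator d′ v′⇝v (dominates d)
  ... | inj₂ v⇝v′ = sym (lowest-dominator d v⇝v′ (dominates d′))

  -- The interval between an immediate dominator and its hybrid

  interval : Fin m → Fin m → Fin m → Bool
  interval v h w = ⌊ v ⇝? w ⌋ ∧ ⌊ w ⇝? h ⌋

  interval⁺ : ∀ {v h w} → v ⇝ w → w ⇝ h → interval v h w ≡ true
  interval⁺ {v} {h} {w} v⇝w w⇝h = ∧-true (holds⇒true (v ⇝? w) v⇝w) (holds⇒true (w ⇝? h) w⇝h)

  interval⁻ : ∀ {v h w} → interval v h w ≡ true → v ⇝ w × w ⇝ h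
  interval⁻ {v} {h} {w} e =
    let e₁ , e₂ = ∧-true⁻ ⌊ v ⇝? w ⌋ e in true⇒holds (v ⇝? w) e₁ , true⇒holds (w ⇝? h) e₂

  path-within : ∀ {S u v} → (∀ {w} → u ⇝ w → w ⇝ v → S w ≡ true) → u ⇝ v → UReach E S u v
  path-within inS here       = here (inS here here)
  path-within inS (step e p) =
    step (inj₁ e) (inS here (step e p)) (path-within (inS ∘ step e) p)

  -- Without `v`, every vertex still descends to `h`. Without another `z`, vertices not below `z`
  -- are reached from `v`, and those below `z` descend to `h`, which a bypass of `z` joins to `v`.
  interval-biconnected : ∀ {v h} → ImmediatelyDominates v h → Biconnected E (interval v h)
  interval-biconnected {v} {h} d = connected , λ z z∈ → connected-without z (z ≟ v) (interval⁻ z∈)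
    where
    connected : ConnectedOn E (interval v h)
    connected = connected-via v λ u u∈ → let v⇝u , u⇝h = interval⁻ u∈ in
      UReach-sym (path-within (λ v⇝w w⇝u → interval⁺ v⇝w (⇝-trans w⇝u u⇝h)) v⇝u)

    module _ (z : Fin m) where

      S : Fin m → Bool
      S = removeV E z (interval v h)

      path-avoiding : ∀ {a b} → v ⇝ a → b ⇝ h → ¬ z ⇝ b ⊎ ¬ a ⇝ z → a ⇝ b → UReach E S a b
      path-avoiding v⇝a b⇝h avoids = path-within λ a⇝w w⇝b →
        removeV⁺ {S = interval v h} (interval⁺ (⇝-trans v⇝a a⇝w) (⇝-trans w⇝b b⇝h))
          λ { refl → [ (λ ¬z⇝b → ¬z⇝b w⇝b) , (λ ¬a⇝z → ¬a⇝z a⇝w) ]′ avoids }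

      connected-without : Dec (z ≡ v) → v ⇝ z × z ⇝ h → ConnectedOn E S
      connected-without (yes refl) _ = connected-via h λ u u∈ →
        let u∈I , u≢v = removeV⁻ {S = interval v h} u∈
            v⇝u , u⇝h = interval⁻ u∈I
        in path-avoiding v⇝u here (inj₂ λ u⇝v → u≢v (⇝-antisym u⇝v v⇝u)) u⇝h
      connected-without (no z≢v) (v⇝z , z⇝h) = connected-via v to-v
        where
        detour : UReach E S v h ⊎ z ≡ h → ∀ {u} → v ⇝ u → u ⇝ h → u ≢ z → UReach E S u v
        detour through {u} v⇝u u⇝h u≢z with z ⇝? u
        ... | no ¬z⇝u = UReach-sym (path-avoiding here u⇝h (inj₁ ¬z⇝u) v⇝u)
        ... | yes z⇝u with through
        ...   | inj₂ refl = contradiction (⇝-antisym u⇝h z⇝u) u≢z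
        ...   | inj₁ v~h  = UReach-trans
          (path-avoiding v⇝u here (inj₂ λ u⇝z → u≢z (⇝-antisym u⇝z z⇝u)) u⇝h) (UReach-sym v~h)

        around : UReach E S v h ⊎ z ≡ h
        around with z ≟ h
        ... | yes z≡h = inj₂ z≡h
        ... | no  z≢h =
          -- As `v` is the lowest dominator, `z` is bypassed: go from `v` down to `p`, which is not
          -- below `z`, over to `g`, which is strictly below `z`, and down to `h`.
          let g , p , z⇝g , g⇝h , z≢g , e , ¬z⇝p = bypass d v⇝z z⇝h (≢-sym z≢v) z≢h
              v⇝g = ⇝-trans v⇝z z⇝g
              v⇝p = parent-below d v⇝g g⇝h
                      (λ v≡g → z≢v (⇝-antisym (subst (z ⇝_) (sym v≡g) z⇝g) v⇝z)) e
              v~p = path-avoiding here (step e g⇝h) (inj₁ ¬z⇝p) v⇝p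
              g~h = path-avoiding v⇝g here (inj₂ λ g⇝z → z≢g (⇝-antisym z⇝g g⇝z)) g⇝h
              p~g = UReach-edge e (UReach-start (UReach-sym v~p)) (UReach-start g~h)
          in inj₁ (UReach-trans v~p (UReach-trans p~g g~h))

        to-v : ∀ u → S u ≡ true → UReach E S u v
        to-v u u∈ = let u∈I , u≢z = removeV⁻ {S = interval v h} u∈
                        v⇝u , u⇝h = interval⁻ u∈I
                    in detour around v⇝u u⇝h u≢z

  hybrid-in-interval : ∀ {v h g} → ImmediatelyDominates v h → Hybrid g →
                       v ⇝ g → g ⇝ h → v ≢ g → HybridIn E (interval v h) g
  hybrid-in-interval d two v⇝g g⇝h v≢g =
    two , interval⁺ v⇝g g⇝h , λ u e → interval⁺ (parent-below d v⇝g g⇝h v≢g e) (step e g⇝h)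

  hybrids-in-biconnected : ∀ {S} → Biconnected E S → ∀ {h h′} →
                           HybridIn E S h → HybridIn E S h′ → h ≡ h′
  hybrids-in-biconnected {S} = biconnected-hybrid-unique (proj₂ (proj₂ N)) S

  hybrid-in-interval-unique : ∀ {v h g} → ImmediatelyDominates v h → Hybrid h → Hybrid g →
                              v ⇝ g → g ⇝ h → v ≢ g → g ≡ h
  hybrid-in-interval-unique d two-h two-g v⇝g g⇝h v≢g = hybrids-in-biconnected (interval-biconnected d)
    (hybrid-in-interval d two-g v⇝g g⇝h v≢g) (hybrid-in-interval d two-h (reaches d) here (distinct d))

  -- The union of the two intervals is biconnected and holds both hybrids together with their
  -- parents, so (N4) applies to it.
  intervals-sharing-two : ∀ {v h v′ h′ a b} →
    ImmediatelyDominates v h → Hybrid h → ImmediatelyDominates v′ h′ → Hybrid h′ → a ≢ b →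
    v ⇝ a → a ⇝ h → v′ ⇝ a → a ⇝ h′ → v ⇝ b → b ⇝ h → v′ ⇝ b → b ⇝ h′ → h ≡ h′
  intervals-sharing-two {v} {h} {v′} {h′} d two d′ two′ a≢b va ah va′ ah′ vb bh vb′ bh′ =
    hybrids-in-biconnected
      (∪-biconnected (interval-biconnected d) (interval-biconnected d′) a≢b
        (interval⁺ va ah) (interval⁺ va′ ah′) (interval⁺ vb bh) (interval⁺ vb′ bh′))
      (HybridIn-mono (λ w → ∨-trueˡ (interval v′ h′ w)) (hybrid-in-interval d two (reaches d) here (distinct d)))
      (HybridIn-mono (λ w → ∨-trueʳ (interval v h w)) (hybrid-in-interval d′ two′ (reaches d′) here (distinct d′)))

  -- The cluster of a hybrid is entered only through the hybrid itself.
  hybrid-comparable : ∀ {h y} → Hybrid h → h ⇝ y → ∀ {w} → w ⇝ y → h ⇝ w ⊎ w ⇝ h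
  hybrid-comparable {h} two h⇝y here = inj₁ h⇝y
  hybrid-comparable {h} two h⇝y (step {u = w} {w = g} e p) with hybrid-comparable two h⇝y p
  ... | inj₂ g⇝h = inj₂ (step e g⇝h)
  ... | inj₁ h⇝g with h ≟ g | h ⇝? w
  ... | yes refl | _       = inj₂ (edge e)
  ... | no _     | yes h⇝w = inj₁ h⇝w
  ... | no h≢g   | no ¬h⇝w =
    -- The parent `w` is not below `h` while `q` is, so `g` is a hybrid. If `h` reaches its
    -- immediate dominator, then `h` reaches `w`; otherwise `h` is a second hybrid in the interval
    -- ending at `g`.
    let q , h⇝q , e′ = last-edge h⇝g h≢g
        two-g = two-parents⇒hybrid (λ { refl → ¬h⇝w h⇝q }) e e′
        d , dom = immediate-dominator two-g
    in contradiction (inside dom two-g (comparable dom h⇝g)) h≢g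
    where
    inside : ∀ {d} → ImmediatelyDominates d g → Hybrid g → h ⇝ d ⊎ d ⇝ h → h ≡ g
    inside dom two-g (inj₁ h⇝d) = contradiction
      (⇝-trans h⇝d (parent-below dom (reaches dom) here (distinct dom) e)) ¬h⇝w
    inside {d} dom two-g (inj₂ d⇝h) with d ≟ h
    ... | yes refl = inside dom two-g (inj₁ here)
    ... | no  d≢h  = hybrid-in-interval-unique dom two-g two d⇝h h⇝g d≢h

  -- Takes the first edge of the path that enters the descendants of `c`. The last component tells
  -- whether it is the initial edge or starts at or below `u`.
  entry-edge : ∀ {c q u x} → ¬ c ⇝ q → q ⟶ u → u ⇝ x → c ⇝ x →
               ∃₂ λ h p → p ⟶ h × ¬ c ⇝ p × c ⇝ h × u ⇝ h × h ⇝ x × (q ≡ p × u ≡ h ⊎ u ⇝ p)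
  entry-edge {c} {u = u} ¬c⇝q e u⇝x c⇝x with c ⇝? u
  ... | yes c⇝u = _ , _ , e , ¬c⇝q , c⇝u , here , u⇝x , inj₁ (refl , refl)
  entry-edge ¬c⇝q e here        c⇝x | no ¬c⇝u = contradiction c⇝x ¬c⇝u
  entry-edge ¬c⇝q e (step e′ p) c⇝x | no ¬c⇝u with entry-edge ¬c⇝u e′ p c⇝x
  ... | h , r , r⟶h , ¬c⇝r , c⇝h , w⇝h , h⇝x , end =
    h , r , r⟶h , ¬c⇝r , c⇝h , step e′ w⇝h , h⇝x ,
    inj₂ ([ (λ { (refl , _) → here }) , step e′ ]′ end)

  -- The path from `v` through `c₀` to `x` first enters the descendants of `c₁` at some `h`, from a
  -- parent not below `c₁`. The path from `v` through `c₁` supplies a second parent.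
  children-meet : ∀ {v c₀ c₁ x} → v ⟶ c₀ → v ⟶ c₁ → c₀ ≢ c₁ → c₀ ⇝ x → c₁ ⇝ x →
                  ∃ λ h → Hybrid h × ImmediatelyDominates v h × c₀ ⇝ h × c₁ ⇝ h × h ⇝ x
  children-meet {v} {c₀} {c₁} {x} e₀ e₁ c₀≢c₁ c₀⇝x c₁⇝x
    with entry-edge (acyclic _ _ e₁) e₀ c₀⇝x c₁⇝x
  ... | h , p₀ , p₀⟶h , ¬c₁⇝p₀ , c₁⇝h , c₀⇝h , h⇝x , origin =
    h , two , v-dominates (d ≟ v) , c₀⇝h , c₁⇝h , h⇝x
    where
    v⇝h : v ⇝ h
    v⇝h = step e₀ c₀⇝h

    v⇝p₀ : v ⇝ p₀
    v⇝p₀ = [ (λ { (refl , _) → here }) , step e₀ ]′ origin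

    other-parent : ∃ λ p₁ → v ⇝ p₁ × p₁ ⟶ h × p₀ ≢ p₁
    other-parent with c₁ ≟ h
    ... | no c₁≢h =
      let p₁ , c₁⇝p₁ , p₁⟶h = last-edge c₁⇝h c₁≢h
      in p₁ , step e₁ c₁⇝p₁ , p₁⟶h , λ { refl → ¬c₁⇝p₀ c₁⇝p₁ }
    -- If `c₁` is `h` itself, its other parent is `v`. Were `p₀` equal to `v`, either `c₀` would be
    -- `h` too or `c₀` would reach `v`.
    ... | yes refl = v , here , e₁ ,
      λ { refl → [ (λ { (_ , c₀≡c₁) → c₀≢c₁ c₀≡c₁ }) , acyclic _ _ e₀ ]′ origin }

    p₁ : Fin m
    p₁ = proj₁ other-parent

    v⇝p₁ : v ⇝ p₁
    v⇝p₁ = proj₁ (proj₂ other-parent)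

    p₁⟶h : p₁ ⟶ h
    p₁⟶h = proj₁ (proj₂ (proj₂ other-parent))

    p₀≢p₁ : p₀ ≢ p₁
    p₀≢p₁ = proj₂ (proj₂ (proj₂ other-parent))

    two : Hybrid h
    two = two-parents⇒hybrid p₀≢p₁ p₀⟶h p₁⟶h

    d : Fin m
    d = proj₁ (immediate-dominator two)

    dom : ImmediatelyDominates d h
    dom = proj₂ (immediate-dominator two)

    d⇝v : d ⇝ v
    -- A dominator at or below `c₁` would put `p₀` below `c₁`. So `d` is strictly above `c₁`, and
    -- domination keeps the parent `v` of `c₁` below `d`.
    d⇝v with comparable dom c₁⇝h
    ... | inj₁ c₁⇝d = contradiction
      (⇝-trans c₁⇝d (parent-below dom (reaches dom) here (distinct dom) p₀⟶h)) ¬c₁⇝p₀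
    ... | inj₂ d⇝c₁ = parent-below dom d⇝c₁ c₁⇝h
      (λ d≡c₁ → ¬c₁⇝p₀ (subst (_⇝ p₀) d≡c₁
        (parent-below dom (reaches dom) here (distinct dom) p₀⟶h))) e₁

    -- If v lay strictly inside the interval [d , h], the edge bypassing v would give
    -- h a third parent or create a second hybrid in the interval.
    no-bypass : d ≢ v → ¬ Bypass v h
    no-bypass d≢v (g , p , v⇝g , g⇝h , v≢g , p⟶g , ¬v⇝p) =
      contradiction (subst (3 ≤_) two three-parents) λ { (s≤s (s≤s ())) }
      where
      q : ∃ λ q → v ⇝ q × q ⟶ g
      q = last-edge v⇝g v≢g

      g≡h : g ≡ h
      g≡h = hybrid-in-interval-unique dom two
        (two-parents⇒hybrid (λ { refl → ¬v⇝p (proj₁ (proj₂ q)) }) p⟶g (proj₂ (proj₂ q)))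
        (⇝-trans d⇝v v⇝g) g⇝h
        (λ d≡g → d≢v (⇝-antisym d⇝v (subst (v ⇝_) (sym d≡g) v⇝g)))

      three-parents : 3 ≤ indeg E h
      three-parents = count-three (λ { refl → ¬v⇝p v⇝p₀ }) (λ p≡p₁ → ¬v⇝p (subst (v ⇝_) (sym p≡p₁) v⇝p₁))
        p₀≢p₁ (subst (p ⟶_) g≡h p⟶g) p₀⟶h p₁⟶h

    v-dominates : Dec (d ≡ v) → ImmediatelyDominates v h
    v-dominates (yes d≡v) = subst (λ v → ImmediatelyDominates v h) d≡v dom
    v-dominates (no  d≢v) = contradiction
      (bypass dom d⇝v v⇝h d≢v (λ { refl → acyclic _ _ e₀ c₀⇝h }))
      (no-bypass d≢v)

  -- Lowest common ancestors

  lca-exists : ∀ {u a b} → u ⇝ a → u ⇝ b → ∃ λ v → IsLCA E a b v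
  lca-exists {a = a} {b} u⇝a u⇝b =
    let v , _ , (v⇝a , v⇝b) , low = lowest (λ v → (v ⇝? a) ×-dec (v ⇝? b)) (u⇝a , u⇝b)
    in v , v⇝a , v⇝b , λ w w⇝a w⇝b v⇝w → low v⇝w (w⇝a , w⇝b)

  lca-cong : ∀ {a b c} → (∀ {w} → w ⇝ c → w ⇝ a → w ⇝ b) → (∀ {w} → w ⇝ c → w ⇝ b → w ⇝ a) →
             ∀ {v} → IsLCA E a c v → IsLCA E b c v
  lca-cong to from (v⇝a , v⇝c , low) =
    to v⇝c v⇝a , v⇝c , λ w w⇝b w⇝c → low w (from w⇝c w⇝b) w⇝c

  child-above : ∀ {v x y} → v ⇝ x → v ⇝ y → ¬ IsLCA E x y v → ∃ λ c → v ⟶ c × c ⇝ x × c ⇝ y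
  child-above {v} {x} {y} v⇝x v⇝y ¬lca =
    decidable-stable (any? λ c → true? (E v c) ×-dec (c ⇝? x) ×-dec (c ⇝? y)) λ none →
      ¬lca (v⇝x , v⇝y , λ w w⇝x w⇝y v⇝w → decidable-stable (w ≟ v) λ w≢v →
        let c , e , c⇝w = first-edge v⇝w (≢-sym w≢v)
        in none (c , e , ⇝-trans c⇝w w⇝x , ⇝-trans c⇝w w⇝y))

-- Partitions of paths and cycles at the hybrid of a gall

-- The graph α and its complement are both connected.
Mixed : ∀ {k} → (Fin k → Fin k → Bool) → Set
Mixed {k} α = ∀ (C : Fin k → Bool) {i j} → C i ≡ true → C j ≡ false →
              ∀ b → ∃₂ λ i j → C i ≡ true × C j ≡ false × α i j ≢ b

-- Colourings of the vertices are enumerated as vectors; `lookup` and `tabulate` translate to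
-- functions up to pointwise equality.
all-vectors? : ∀ {A : Set} → (∀ {P : A → Set} → Decidable P → Dec (∀ a → P a)) →
               ∀ k {Q : Vec A k → Set} → Decidable Q → Dec (∀ u → Q u)
all-vectors? all-A? zero    Q? = map′ (λ { q [] → q }) (λ q → q []) (Q? [])
all-vectors? all-A? (suc k) Q? =
  map′ (λ { q (a ∷ u) → q a u }) (λ q a u → q (a ∷ u))
       (all-A? λ a → all-vectors? all-A? k (λ u → Q? (a ∷ u)))

all-booleans? : ∀ {P : Bool → Set} → Decidable P → Dec (∀ b → P b)
all-booleans? P? = map′ (λ { (t , f) true → t ; (t , f) false → f }) (λ p → p true , p false)
                        (P? true ×-dec P? false)

-- The part of a leaf relative to a child c of the top of a gall with hybrid h:
-- below h, below c but not below h, or not below c.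
data Part : Set where
  under aside beyond : Part

_≟ᴾ_ : (p q : Part) → Dec (p ≡ q)
under  ≟ᴾ under  = yes refl
under  ≟ᴾ aside  = no λ ()
under  ≟ᴾ beyond = no λ ()
aside  ≟ᴾ under  = no λ ()
aside  ≟ᴾ aside  = yes refl
aside  ≟ᴾ beyond = no λ ()
beyond ≟ᴾ under  = no λ ()
beyond ≟ᴾ aside  = no λ ()
beyond ≟ᴾ beyond = yes refl

all-parts? : ∀ {P : Part → Set} → Decidable P → Dec (∀ p → P p)
all-parts? P? = map′ (λ { (u , a , b) under → u ; (u , a , b) aside → a ; (u , a , b) beyond → b })
                     (λ p → p under , p aside , p beyond)
                     (P? under ×-dec P? aside ×-dec P? beyond)

-- The ways in which a partition can fail to come from a gall whose top has label b.
Violation : ∀ {k} → (Fin k → Fin k → Bool) → Bool → (Fin k → Part) → Set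
Violation α b u =
    (∃ λ p → ∀ i → u i ≢ p)
  ⊎ (∃₂ λ i j → u i ≡ aside × u j ≡ beyond × α i j ≢ b)
  ⊎ (∃₂ λ i j → u i ≡ under × u j ≡ under × ∃ λ l → u l ≢ under × α i l ≢ α j l)

violation? : ∀ {k} (α : Fin k → Fin k → Bool) b u → Dec (Violation α b u)
violation? α b u =
  any-part? (λ p → all? λ i → ¬? (u i ≟ᴾ p))
  ⊎-dec any? (λ i → any? λ j → (u i ≟ᴾ aside) ×-dec (u j ≟ᴾ beyond) ×-dec ¬? (α i j Bool.≟ b))
  ⊎-dec any? (λ i → any? λ j → (u i ≟ᴾ under) ×-dec (u j ≟ᴾ under) ×-dec
              any? λ l → ¬? (u l ≟ᴾ under) ×-dec ¬? (α i l Bool.≟ α j l))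
  where
  any-part? : ∀ {P : Part → Set} → Decidable P → Dec (∃ P)
  any-part? P? = map′ [ (under ,_) , [ (aside ,_) , (beyond ,_) ]′ ]′
    (λ { (under , p) → inj₁ p ; (aside , p) → inj₂ (inj₁ p) ; (beyond , p) → inj₂ (inj₂ p) })
    (P? under ⊎-dec P? aside ⊎-dec P? beyond)

-- Finite checks on short paths and cycles

pathAdj? : ∀ {k} (i j : Fin k) → Dec (PathAdj i j)
pathAdj? i j = (suc (toℕ i) ℕ.≟ toℕ j) ⊎-dec (suc (toℕ j) ℕ.≟ toℕ i)

cycleAdj? : ∀ {k} (i j : Fin k) → Dec (CycleAdj i j)
cycleAdj? {k} i j = pathAdj? i j
  ⊎-dec ((toℕ i ℕ.≟ 0) ×-dec (suc (toℕ j) ℕ.≟ k)) ⊎-dec ((toℕ j ℕ.≟ 0) ×-dec (suc (toℕ i) ℕ.≟ k))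

pathMatrix cycleMatrix : ∀ k → Fin k → Fin k → Bool
pathMatrix  k i j = ⌊ pathAdj? i j ⌋
cycleMatrix k i j = ⌊ cycleAdj? i j ⌋

CutMixed : ∀ {k} → (Fin k → Fin k → Bool) → (Fin k → Bool) → Set
CutMixed α C = (∃ λ b → ∀ i → C i ≡ b) ⊎
               (∀ b → ∃₂ λ i j → C i ≡ true × C j ≡ false × α i j ≢ b)

cut-mixed? : ∀ {k} (α : Fin k → Fin k → Bool) C → Dec (CutMixed α C)
cut-mixed? α C =
  map′ [ (true ,_) , (false ,_) ]′ (λ { (true , c) → inj₁ c ; (false , c) → inj₂ c })
       (all? (λ i → C i Bool.≟ true) ⊎-dec all? (λ i → C i Bool.≟ false))
  ⊎-dec all-booleans? λ b → any? λ i → any? λ j →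
          (C i Bool.≟ true) ×-dec (C j Bool.≟ false) ×-dec ¬? (α i j Bool.≟ b)

all-cuts-mixed? : ∀ {k} (α : Fin k → Fin k → Bool) → Dec (∀ u → CutMixed α (lookup u))
all-cuts-mixed? {k} α = all-vectors? all-booleans? k (cut-mixed? α ∘ lookup)

cuts-mixed⇒Mixed : ∀ {k} {α : Fin k → Fin k → Bool} → (∀ u → CutMixed α (lookup u)) → Mixed α
cuts-mixed⇒Mixed cuts C {i} {j} Ci Cj b with cuts (tabulate C)
... | inj₁ (b′ , const) = contradiction
  (trans (sym (trans (at i) Ci)) (trans (const i) (trans (sym (const j)) (trans (at j) Cj)))) λ ()
  where
  at : ∀ i → lookup (tabulate C) i ≡ C i
  at = lookup∘tabulate C
... | inj₂ crossing =
  let x , y , Cx , Cy , α≢ = crossing b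
  in x , y , trans (sym (lookup∘tabulate C x)) Cx , trans (sym (lookup∘tabulate C y)) Cy , α≢

abstract

  mixed-path₄ : Mixed (pathMatrix 4)
  mixed-path₄ = cuts-mixed⇒Mixed (toWitness {a? = all-cuts-mixed? (pathMatrix 4)} _)

  mixed-path₆ : Mixed (pathMatrix 6)
  mixed-path₆ = cuts-mixed⇒Mixed (toWitness {a? = all-cuts-mixed? (pathMatrix 6)} _)

  mixed-cycle₅ : Mixed (cycleMatrix 5)
  mixed-cycle₅ = cuts-mixed⇒Mixed (toWitness {a? = all-cuts-mixed? (cycleMatrix 5)} _)

  mixed-cycle₆ : Mixed (cycleMatrix 6)
  mixed-cycle₆ = cuts-mixed⇒Mixed (toWitness {a? = all-cuts-mixed? (cycleMatrix 6)} _)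

AllViolate : ∀ k → (Fin k → Fin k → Bool) → Set
AllViolate k α = ∀ b (u : Vec Part k) → Violation α b (lookup u)

all-violate? : ∀ k α → Dec (AllViolate k α)
all-violate? k α = all-booleans? λ b → all-vectors? all-parts? k (violation? α b ∘ lookup)

abstract

  -- Checked by enumeration. These cycles have no proper module of size above one, so only a single
  -- vertex can be `under`; the path left by it is connected and co-connected, so no split into
  -- `aside` and `beyond` is uniform.
  cycle₅-violates : AllViolate 5 (cycleMatrix 5)
  cycle₅-violates = toWitness {a? = all-violate? 5 (cycleMatrix 5)} _

  cycle₆-violates : AllViolate 6 (cycleMatrix 6)
  cycle₆-violates = toWitness {a? = all-violate? 6 (cycleMatrix 6)} _

window : Fin 3 → Fin 4 → Fin 6
window zero             q = inject₁ (inject₁ q)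
window (suc zero)       q = inject₁ (suc q)
window (suc (suc zero)) q = suc (suc q)

window-injective : ∀ s {q r} → window s q ≡ window s r → q ≡ r
window-injective s {q} {r} = toWitness
  {a? = all? λ s → all? λ q → all? λ r → (window s q ≟ window s r) →-dec (q ≟ r)} _ s q r

window-path : ∀ s q r → pathMatrix 4 q r ≡ pathMatrix 6 (window s q) (window s r)
window-path = toWitness
  {a? = all? λ s → all? λ q → all? λ r → pathMatrix 4 q r Bool.≟ pathMatrix 6 (window s q) (window s r)} _

-- A P₄ below `c` and partly below `h`, which `no-family-across-hybrid` excludes.
WindowAcross : (Fin 6 → Part) → Set
WindowAcross u = ∃ λ s → (∀ q → u (window s q) ≢ beyond) ×
                         (∃ λ q → u (window s q) ≡ under) × (∃ λ q → u (window s q) ≡ aside)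

window-across? : ∀ u → Dec (WindowAcross u)
window-across? u = any? λ s → all? (λ q → ¬? (u (window s q) ≟ᴾ beyond))
  ×-dec any? (λ q → u (window s q) ≟ᴾ under) ×-dec any? (λ q → u (window s q) ≟ᴾ aside)

-- With vertex z of P₆ under the hybrid, the shorter component of P₆ − z lies aside.
shortSide : Fin 6 → Fin 6 → Part
shortSide z i =
  if ⌊ i ≟ z ⌋ then under
  else if ⌊ toℕ z ℕ.<? 3 ⌋ then (if ⌊ toℕ i ℕ.<? toℕ z ⌋ then aside else beyond)
  else (if ⌊ toℕ z ℕ.<? toℕ i ⌋ then aside else beyond)

shortSide-self : ∀ z → shortSide z z ≡ under
shortSide-self = toWitness {a? = all? λ z → shortSide z z ≟ᴾ under} _

shortSide-under : ∀ z i → shortSide z i ≡ under → i ≡ z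
shortSide-under = toWitness {a? = all? λ z → all? λ i → (shortSide z i ≟ᴾ under) →-dec (i ≟ z)} _

-- Excluding `zero` later ensures that leaf 0, which selects the child `c₀`, is not below the
-- hybrid.
ShortSide : (Fin 6 → Part) → Set
ShortSide u = ∃ λ z → z ≢ zero × (∀ i → u i ≡ shortSide z i)

shortSide? : ∀ u → Dec (ShortSide u)
shortSide? u = any? λ z → ¬? (z ≟ zero) ×-dec all? λ i → u i ≟ᴾ shortSide z i

abstract

  -- Without a violation, one interior vertex is `under` and the two components left are `aside` and
  -- `beyond`. If the longer one is `aside`, it has at least three vertices and forms a window with
  -- that vertex.
  path₆-partitions : ∀ b (u : Vec Part 6) →
    Violation (pathMatrix 6) b (lookup u) ⊎ WindowAcross (lookup u) ⊎ ShortSide (lookup u)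
  path₆-partitions = toWitness
    {a? = all-booleans? λ b → all-vectors? all-parts? 6 λ u →
      violation? (pathMatrix 6) b (lookup u) ⊎-dec window-across? (lookup u) ⊎-dec shortSide? (lookup u)} _

-- Families of leaves inducing a connected and co-connected graph

-- Labels enter only through `β`, so that negating `β` yields the same results for the complement.
module Explained {m : ℕ} (E : Fin m → Fin m → Bool) (N : NontrivialGT E) (β : Fin m → Bool) where

  open GalledTree E N
  open ImmediatelyDominates

  record Family (k : ℕ) (α : Fin k → Fin k → Bool) : Set where
    field
      leaf      : Fin k → Fin m
      leaf-sink : ∀ i {w} → leaf i ⇝ w → leaf i ≡ w
      leaf-inj  : ∀ {i j} → leaf i ≡ leaf j → i ≡ j
      explained : ∀ {i j} → i ≢ j → ∀ {v} → IsLCA E (leaf i) (leaf j) v → α i j ≡ β v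

  open Family

  subfamily : ∀ {k l α α′} (F : Family k α) (g : Fin l → Fin k) → (∀ {i j} → g i ≡ g j → i ≡ j) →
              (∀ i j → α′ i j ≡ α (g i) (g j)) → Family l α′
  subfamily F g g-inj α′≡ = record
    { leaf      = leaf F ∘ g
    ; leaf-sink = leaf-sink F ∘ g
    ; leaf-inj  = g-inj ∘ leaf-inj F
    ; explained = λ i≢j lca → trans (α′≡ _ _) (explained F (i≢j ∘ g-inj) lca)
    }

  record Top {k α} (F : Family k α) (v : Fin m) : Set where
    field
      above  : ∀ i → v ⇝ leaf F i
      missed : ∀ {c} → v ⟶ c → ∃ λ i → ¬ c ⇝ leaf F i

  open Top

  top-exists : ∀ {k α} (F : Family k α) {u} → (∀ i → u ⇝ leaf F i) → ∃ λ v → u ⇝ v × Top F v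
  top-exists {k} F above-u =
    let v , u⇝v , above-v , low = lowest (λ v → all? (λ i → v ⇝? leaf F i)) above-u
    in v , u⇝v , record
      { above  = above-v
      ; missed = λ {c} e → ¬∀⟶∃¬ k (λ i → c ⇝ leaf F i) (λ i → c ⇝? leaf F i) λ above-c →
          ⟶⇒≢ e (sym (low (edge e) above-c))
      }

  record Gall {k α} (F : Family k α) (v c₀ : Fin m) : Set where
    field
      c₁ h      : Fin m
      v⟶c₁      : v ⟶ c₁
      hybrid    : Hybrid h
      dominated : ImmediatelyDominates v h
      c₀⇝h      : c₀ ⇝ h
      c₁⇝h      : c₁ ⇝ h
      below-h   : ∃ λ i → h ⇝ leaf F i
      crossing  : ∃ λ j → c₁ ⇝ leaf F j × ¬ c₀ ⇝ leaf F j

  -- Cut the family into the leaves below `c₀` and the rest. Some pair across the cut disagrees with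
  -- the label of `v`, so `v` is not its lowest common ancestor and another child `c₁` lies above
  -- both leaves; it meets `c₀` in a hybrid.
  gall : ∀ {k α} → Mixed α → (F : Family k α) → ∀ {v c₀ i} → Top F v → v ⟶ c₀ → c₀ ⇝ leaf F i → Gall F v c₀
  gall mixed F {v} {c₀} top e₀ c₀⇝i =
    let j , ¬c₀⇝j = missed top e₀
        x , y , x∈ , y∉ , αxy≢ = mixed (λ i → ⌊ c₀ ⇝? leaf F i ⌋)
          (holds⇒true (c₀ ⇝? _) c₀⇝i) (fails⇒false (c₀ ⇝? leaf F j) ¬c₀⇝j) (β v)
        c₀⇝x  = true⇒holds (c₀ ⇝? leaf F x) x∈
        ¬c₀⇝y = λ c₀⇝y → contradiction (trans (sym y∉) (holds⇒true (c₀ ⇝? leaf F y) c₀⇝y)) λ ()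
        c₁ , e₁ , c₁⇝x , c₁⇝y = child-above (above top x) (above top y)
          (αxy≢ ∘ explained F (λ x≡y → ¬c₀⇝y (subst (λ i → c₀ ⇝ leaf F i) x≡y c₀⇝x)))
        h , hybrid , dominated , c₀⇝h , c₁⇝h , h⇝x =
          children-meet e₀ e₁ (reach-≢ c₁⇝y ¬c₀⇝y) c₀⇝x c₁⇝x
    in record
      { c₁ = c₁ ; h = h ; v⟶c₁ = e₁ ; hybrid = hybrid ; dominated = dominated
      ; c₀⇝h = c₀⇝h ; c₁⇝h = c₁⇝h ; below-h = x , h⇝x ; crossing = y , c₁⇝y , ¬c₀⇝y }

  -- The family's own gall would share two vertices with the given one.
  no-family-across-hybrid : ∀ {k α} → Mixed α → (F : Family k α) → ∀ {v c h} →
    v ⟶ c → c ⇝ h → Hybrid h → ImmediatelyDominates v h → (∀ i → c ⇝ leaf F i) →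
    ∀ {i j} → h ⇝ leaf F i → ¬ h ⇝ leaf F j → ⊥
  no-family-across-hybrid mixed F {v} {c} {h} e c⇝h two dom c-above {i} {j} h⇝i ¬h⇝j
    with top-exists F c-above
  ... | v′ , c⇝v′ , top with hybrid-comparable two h⇝i (above top i)
  ... | inj₁ h⇝v′ = ¬h⇝j (⇝-trans h⇝v′ (above top j))
  ... | inj₂ v′⇝h =
    let c₀ , e₀ , c₀⇝h = first-edge v′⇝h (λ v′≡h → ¬h⇝j (subst (_⇝ leaf F j) v′≡h (above top j)))
        G = gall mixed F top e₀ (⇝-trans c₀⇝h h⇝i)
        open Gall G using (dominated; hybrid)
        -- Both intervals contain `v′` and its child `c₀`. Equal hybrids have equal immediate
        -- dominators, yet `v′` lies below the child `c` of `v`.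
        h≡h′ = intervals-sharing-two dom two dominated hybrid (⟶⇒≢ e₀)
                 (step e c⇝v′) v′⇝h here (step e₀ (Gall.c₀⇝h G))
                 (step e (⇝-trans c⇝v′ (edge e₀))) c₀⇝h (edge e₀) (Gall.c₀⇝h G)
        v≡v′ = immediate-dominator-unique dom
                 (subst (ImmediatelyDominates v′) (sym h≡h′) dominated)
    in acyclic _ _ e (subst (c ⇝_) (sym v≡v′) c⇝v′)

  module _ {k α} (F : Family k α) {v h : Fin m} (v-above : ∀ i → v ⇝ leaf F i) (two : Hybrid h)
           (dom : ImmediatelyDominates v h) where

    -- A common ancestor of `leaf F i` and `leaf F l` is comparable with `h` but not below it, hence
    -- above `h` and all leaves there.
    below-hybrid-module : ∀ {i j l} → h ⇝ leaf F i → h ⇝ leaf F j → ¬ h ⇝ leaf F l → α i l ≡ α j l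
    below-hybrid-module {i} {j} {l} h⇝i h⇝j ¬h⇝l =
      let w , lca = lca-exists (v-above i) (v-above l)
      in trans (explained F (λ { refl → ¬h⇝l h⇝i }) lca)
               (sym (explained F (λ { refl → ¬h⇝l h⇝j }) (lca-cong (swap h⇝i h⇝j) (swap h⇝j h⇝i) lca)))
      where
      swap : ∀ {i j w} → h ⇝ leaf F i → h ⇝ leaf F j → w ⇝ leaf F l → w ⇝ leaf F i → w ⇝ leaf F j
      swap h⇝i h⇝j w⇝l w⇝i with hybrid-comparable two h⇝i w⇝i
      ... | inj₁ h⇝w = contradiction (⇝-trans h⇝w w⇝l) ¬h⇝l
      ... | inj₂ w⇝h = ⇝-trans w⇝h h⇝j

    -- Otherwise another child of `v` lies above both leaves and meets `c` in a hybrid above the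
    -- first. Its interval shares `v` and `c` with that of `h`, so it is `h`.
    across-side : ∀ {c a b} → v ⟶ c → c ⇝ h → c ⇝ leaf F a → ¬ h ⇝ leaf F a → ¬ c ⇝ leaf F b →
                  α a b ≡ β v
    across-side {c} {a} {b} e c⇝h c⇝a ¬h⇝a ¬c⇝b = decidable-stable (α a b Bool.≟ β v) λ α≢β →
      let c′ , e′ , c′⇝a , c′⇝b = child-above (v-above a) (v-above b)
            (α≢β ∘ explained F (λ { refl → ¬c⇝b c⇝a }))
          h′ , two′ , dom′ , c⇝h′ , _ , h′⇝a = children-meet e e′ (reach-≢ c′⇝b ¬c⇝b) c⇝a c′⇝a
          h≡h′ = intervals-sharing-two dom two dom′ two′ (⟶⇒≢ e)
                   here (reaches dom) here (reaches dom′) (edge e) c⇝h (edge e) c⇝h′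
      in ¬h⇝a (subst (_⇝ leaf F a) (sym h≡h′) h′⇝a)

    module Side {c : Fin m} (e : v ⟶ c) (c⇝h : c ⇝ h) where

      part : Fin k → Part
      part i = if ⌊ h ⇝? leaf F i ⌋ then under else if ⌊ c ⇝? leaf F i ⌋ then aside else beyond

      part-under : ∀ {i} → h ⇝ leaf F i → part i ≡ under
      part-under {i} h⇝i with h ⇝? leaf F i
      ... | yes _   = refl
      ... | no ¬h⇝i = contradiction h⇝i ¬h⇝i

      part-aside : ∀ {i} → ¬ h ⇝ leaf F i → c ⇝ leaf F i → part i ≡ aside
      part-aside {i} ¬h⇝i c⇝i with h ⇝? leaf F i | c ⇝? leaf F i
      ... | yes h⇝i | _       = contradiction h⇝i ¬h⇝i
      ... | no _    | yes _   = refl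
      ... | no _    | no ¬c⇝i = contradiction c⇝i ¬c⇝i

      part-beyond : ∀ {i} → ¬ c ⇝ leaf F i → part i ≡ beyond
      part-beyond {i} ¬c⇝i with h ⇝? leaf F i | c ⇝? leaf F i
      ... | yes h⇝i | _       = contradiction (⇝-trans c⇝h h⇝i) ¬c⇝i
      ... | no _    | yes c⇝i = contradiction c⇝i ¬c⇝i
      ... | no _    | no _    = refl

      part-under⁻ : ∀ {i} → part i ≡ under → h ⇝ leaf F i
      part-under⁻ {i} eq with h ⇝? leaf F i | c ⇝? leaf F i
      part-under⁻ eq | yes h⇝i | _     = h⇝i
      part-under⁻ () | no _    | yes _
      part-under⁻ () | no _    | no _

      part-aside⁻ : ∀ {i} → part i ≡ aside → c ⇝ leaf F i × ¬ h ⇝ leaf F i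
      part-aside⁻ {i} eq with h ⇝? leaf F i | c ⇝? leaf F i
      part-aside⁻ () | yes _    | _
      part-aside⁻ eq | no ¬h⇝i | yes c⇝i = c⇝i , ¬h⇝i
      part-aside⁻ () | no _    | no _

      part-beyond⁻ : ∀ {i} → part i ≡ beyond → ¬ c ⇝ leaf F i
      part-beyond⁻ eq c⇝i with h ⇝? leaf F _
      ... | yes h⇝i = contradiction (trans (sym eq) (part-under h⇝i)) λ ()
      ... | no ¬h⇝i = contradiction (trans (sym eq) (part-aside ¬h⇝i c⇝i)) λ ()

      -- The three hypotheses fill the three parts; `across-side` and `below-hybrid-module` refute
      -- the other kinds of violation.
      no-violation : ∀ {u} → (∀ i → u i ≡ part i) →
        (∃ λ i → h ⇝ leaf F i) → (∃ λ i → c ⇝ leaf F i × ¬ h ⇝ leaf F i) → (∃ λ i → ¬ c ⇝ leaf F i) →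
        ¬ Violation α (β v) u
      no-violation u≗ (i , h⇝i) _ _ (inj₁ (under , none)) = none i (trans (u≗ i) (part-under h⇝i))
      no-violation u≗ _ (i , c⇝i , ¬h⇝i) _ (inj₁ (aside , none)) = none i (trans (u≗ i) (part-aside ¬h⇝i c⇝i))
      no-violation u≗ _ _ (i , ¬c⇝i) (inj₁ (beyond , none)) = none i (trans (u≗ i) (part-beyond ¬c⇝i))
      no-violation u≗ _ _ _ (inj₂ (inj₁ (i , j , ui , uj , α≢))) =
        let c⇝i , ¬h⇝i = part-aside⁻ (trans (sym (u≗ i)) ui)
        in α≢ (across-side e c⇝h c⇝i ¬h⇝i (part-beyond⁻ (trans (sym (u≗ j)) uj)))
      no-violation u≗ _ _ _ (inj₂ (inj₂ (i , j , ui , uj , l , ul , α≢))) =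
        α≢ (below-hybrid-module (part-under⁻ (trans (sym (u≗ i)) ui)) (part-under⁻ (trans (sym (u≗ j)) uj))
                                (λ h⇝l → ul (trans (u≗ l) (part-under h⇝l))))

  -- With a second leaf below it, `v` cannot be the sink `leaf F zero`.
  child-towards : ∀ {k α} (F : Family (suc (suc k)) α) {v} → Top F v → ∃ λ c → v ⟶ c × c ⇝ leaf F zero
  child-towards F top = first-edge (above top zero) λ v≡0 →
    contradiction (leaf-inj F (leaf-sink F zero (subst (_⇝ leaf F (suc zero)) v≡0 (above top (suc zero))))) λ ()

  module InGall {k α} (F : Family k α) {v c₀ : Fin m} (top : Top F v) (e₀ : v ⟶ c₀) (G : Gall F v c₀) where

    open Gall G public

    crosser : Fin k
    crosser = proj₁ crossing

    c₁⇝crosser : c₁ ⇝ leaf F crosser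
    c₁⇝crosser = proj₁ (proj₂ crossing)

    ¬c₀⇝crosser : ¬ c₀ ⇝ leaf F crosser
    ¬c₀⇝crosser = proj₂ (proj₂ crossing)

    ¬h⇝crosser : ¬ h ⇝ leaf F crosser
    ¬h⇝crosser = ¬c₀⇝crosser ∘ ⇝-trans c₀⇝h

    module Part₀ = Side F (above top) hybrid dominated e₀ c₀⇝h
    module Part₁ = Side F (above top) hybrid dominated v⟶c₁ c₁⇝h

    -- The side of `c₁` is chosen because `crosser` is a leaf aside there; for `c₀` the gall
    -- supplies no such leaf.
    no-violation₁ : ¬ Violation α (β v) (lookup (tabulate Part₁.part))
    no-violation₁ = Part₁.no-violation (lookup∘tabulate Part₁.part)
      below-h (crosser , c₁⇝crosser , ¬h⇝crosser) (missed top v⟶c₁)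

  no-violating-family : ∀ {k α} → Mixed α → AllViolate (suc (suc k)) α → ¬ Family (suc (suc k)) α
  no-violating-family mixed violates F with top-exists F (root-reaches ∘ leaf F)
  ... | v , _ , top with child-towards F top
  ... | _ , e₀ , c₀⇝0 = no-violation₁ (violates (β v) (tabulate Part₁.part))
    where open InGall F top e₀ (gall mixed F top e₀ c₀⇝0)

  no-cycle₅ : ¬ Family 5 (cycleMatrix 5)
  no-cycle₅ = no-violating-family mixed-cycle₅ cycle₅-violates

  no-cycle₆ : ¬ Family 6 (cycleMatrix 6)
  no-cycle₆ = no-violating-family mixed-cycle₆ cycle₆-violates

  -- Of the outcomes of `path₆-partitions`, a violation is refuted by `no-violation`, and a window
  -- would be a P₄ below `c` straddling `h`.
  short-side-aside : (F : Family 6 (pathMatrix 6)) → ∀ {v h c} (above : ∀ i → v ⇝ leaf F i)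
    (two : Hybrid h) (dom : ImmediatelyDominates v h) (e : v ⟶ c) (c⇝h : c ⇝ h) →
    (∃ λ i → h ⇝ leaf F i) → (∃ λ i → c ⇝ leaf F i × ¬ h ⇝ leaf F i) → (∃ λ i → ¬ c ⇝ leaf F i) →
    ∃ λ z → z ≢ zero × (∀ i → Side.part F above two dom e c⇝h i ≡ shortSide z i)
  short-side-aside F {v} {c = c} above two dom e c⇝h u a b =
    cases (path₆-partitions (β v) (tabulate part))
    where
    open Side F above two dom e c⇝h

    at : ∀ i → lookup (tabulate part) i ≡ part i
    at = lookup∘tabulate part

    cases : Violation (pathMatrix 6) (β v) (lookup (tabulate part)) ⊎
                    WindowAcross (lookup (tabulate part)) ⊎ ShortSide (lookup (tabulate part)) →
            ∃ λ z → z ≢ zero × (∀ i → part i ≡ shortSide z i)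
    cases (inj₁ violation) = contradiction violation (no-violation at u a b)
    cases (inj₂ (inj₂ (z , z≢0 , short))) = z , z≢0 , λ i → trans (sym (at i)) (short i)
    cases (inj₂ (inj₁ (s , inside , (q , under-q) , (r , aside-r)))) = ⊥-elim
      (no-family-across-hybrid mixed-path₄ (subfamily F (window s) (window-injective s) (window-path s))
        e c⇝h two dom inside-c {q} {r}
        (part-under⁻ (trans (sym (at (window s q))) under-q))
        (proj₂ (part-aside⁻ (trans (sym (at (window s r))) aside-r))))
      where
      inside-c : ∀ q → c ⇝ leaf F (window s q)
      inside-c q = decidable-stable (c ⇝? _) λ ¬c⇝q →
        inside q (trans (at (window s q)) (part-beyond ¬c⇝q))

  -- Both children of the gall's top hold the shorter component of P₆ − z, which is
  -- absurd as the leaves below both of them lie below the hybrid.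
  no-path₆ : ¬ Family 6 (pathMatrix 6)
  no-path₆ F with top-exists F (root-reaches ∘ leaf F)
  ... | v , _ , top with child-towards F top
  ... | c₀ , e₀ , c₀⇝0 = in-gall (gall mixed-path₆ F top e₀ c₀⇝0)
    where
    in-gall : ¬ Gall F v c₀
    in-gall G = compare
      (short-side-aside F (above top) hybrid dominated v⟶c₁ c₁⇝h
        below-h (crosser , c₁⇝crosser , ¬h⇝crosser) (missed top v⟶c₁))
      where
      open InGall F top e₀ G

      agree : ∀ {z₀ z₁} → (∀ i → Part₀.part i ≡ shortSide z₀ i) →
              (∀ i → Part₁.part i ≡ shortSide z₁ i) → z₀ ≡ z₁
      -- Both sides have the same leaves `under`, namely those below the common hybrid.
      agree {z₀} {z₁} short₀ short₁ = shortSide-under z₁ z₀ (trans (sym (short₁ z₀))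
        (Part₁.part-under (Part₀.part-under⁻ (trans (short₀ z₀) (shortSide-self z₀)))))

      ¬equal : ¬ Part₀.part crosser ≡ Part₁.part crosser
      ¬equal eq = contradiction
        (trans (sym (Part₀.part-beyond ¬c₀⇝crosser))
               (trans eq (Part₁.part-aside ¬h⇝crosser c₁⇝crosser))) λ ()

      compare : ¬ (∃ λ z₁ → z₁ ≢ zero × (∀ i → Part₁.part i ≡ shortSide z₁ i))
      compare (z₁ , z₁≢0 , short₁) = against
        (short-side-aside F (above top) hybrid dominated e₀ c₀⇝h
          below-h (zero , c₀⇝0 , ¬h⇝0) (crosser , ¬c₀⇝crosser))
        where
        -- This makes leaf 0 a leaf aside for `c₀`, so `short-side-aside` applies to that side too.
        ¬h⇝0 : ¬ h ⇝ leaf F zero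
        ¬h⇝0 h⇝0 = z₁≢0 (sym (shortSide-under z₁ zero
          (trans (sym (short₁ zero)) (Part₁.part-under h⇝0))))

        against : ¬ (∃ λ z₀ → z₀ ≢ zero × (∀ i → Part₀.part i ≡ shortSide z₀ i))
        against (z₀ , _ , short₀) = ¬equal (trans (short₀ crosser)
          (trans (cong (λ z → shortSide z crosser) (agree short₀ short₁)) (sym (short₁ crosser))))

-- Induced copies in explained graphs

reflected : ∀ {P : Set} (d : Dec P) {b} → (b ≡ true) ⇔ P → ⌊ d ⌋ ≡ b
reflected (yes p) b⇔P = sym (Equivalence.from b⇔P p)
reflected (no ¬p) b⇔P = sym (≢true⇒false (¬p ∘ Equivalence.to b⇔P))

-- Take the first six vertices. From length 7 on, none of them is the last vertex of the cycle, so
-- the closing edge is not among them.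
long-hole⇒path₆ : ∀ {n k} (a : Fin n → Fin n → Bool) → 7 ≤ k → InducedCopy k CycleAdj a → HasP6 a
long-hole⇒path₆ {k = k} a 7≤k (f , f-inj , f-adj) =
  f ∘ embed , inject≤-injective 6≤k 6≤k _ _ ∘ f-inj , λ i j →
    mk⇔ (path i j ∘ Equivalence.to (f-adj (embed i) (embed j)))
        (Equivalence.from (f-adj (embed i) (embed j)) ∘ inj₁ ∘ path⁻ i j)
  where
  6≤k : 6 ≤ k
  6≤k = ℕ.<⇒≤ 7≤k

  embed : Fin 6 → Fin k
  embed i = inject≤ i 6≤k

  toℕ-embed : ∀ i → toℕ (embed i) ≡ toℕ i
  toℕ-embed i = toℕ-inject≤ i 6≤k

  not-last : ∀ (i : Fin 6) → suc (toℕ (embed i)) ≢ k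
  not-last i last = ℕ.<-irrefl last
    (subst (λ l → suc l < k) (sym (toℕ-embed i)) (ℕ.≤-trans (s≤s (toℕ<n i)) 7≤k))

  path : ∀ i j → CycleAdj (embed i) (embed j) → PathAdj i j
  path i j (inj₁ p) = subst₂ (λ x y → suc x ≡ y ⊎ suc y ≡ x) (toℕ-embed i) (toℕ-embed j) p
  path i j (inj₂ (inj₁ (_ , last))) = contradiction last (not-last j)
  path i j (inj₂ (inj₂ (_ , last))) = contradiction last (not-last i)

  path⁻ : ∀ i j → PathAdj i j → PathAdj (embed i) (embed j)
  path⁻ i j = subst₂ (λ x y → suc x ≡ y ⊎ suc y ≡ x) (sym (toℕ-embed i)) (sym (toℕ-embed j))

module _ {n m : ℕ} (E : Fin m → Fin m → Bool) (N : NontrivialGT E) (β : Fin m → Bool)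
         (ι : Fin n → Fin m) (ι-inj : ∀ {x y} → ι x ≡ ι y → x ≡ y)
         (ι-sink : ∀ x {w} → Reach E (ι x) w → ι x ≡ w)
         (a : Fin n → Fin n → Bool)
         (a-explained : ∀ {x y} → x ≢ y → ∀ {v} → IsLCA E (ι x) (ι y) v → a x y ≡ β v) where

  open Explained E N β

  family : ∀ {k α} (f : Fin k → Fin n) → (∀ {i j} → f i ≡ f j → i ≡ j) →
           (∀ i j → α i j ≡ a (f i) (f j)) → Family k α
  family = subfamily record
    { leaf = ι ; leaf-sink = ι-sink ; leaf-inj = ι-inj ; explained = a-explained }

  explained⇒no-path₆ : ¬ HasP6 a
  explained⇒no-path₆ (f , f-inj , f-adj) =
    no-path₆ (family f f-inj λ i j → reflected (pathAdj? i j) (f-adj i j))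

  explained⇒no-hole : ¬ HasHole a
  explained⇒no-hole (k , 5≤k , copy@(f , f-inj , f-adj)) with k ℕ.≟ 5 | k ℕ.≟ 6
  ... | yes refl | _        = no-cycle₅ (family f f-inj λ i j → reflected (cycleAdj? i j) (f-adj i j))
  ... | no _     | yes refl = no-cycle₆ (family f f-inj λ i j → reflected (cycleAdj? i j) (f-adj i j))
  ... | no k≢5   | no k≢6   = explained⇒no-path₆ (long-hole⇒path₆ a
    (ℕ.≤∧≢⇒< (ℕ.≤∧≢⇒< 5≤k (≢-sym k≢5)) (≢-sym k≢6)) copy)

module _ {n : ℕ} (a : Fin n → Fin n → Bool) (one-vertex : ∀ (x y : Fin n) → x ≡ y) where

  one-vertex⇒no-hole : ¬ HasHole a
  one-vertex⇒no-hole (_ , s≤s (s≤s _) , f , f-inj , _) =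
    contradiction (f-inj (one-vertex (f zero) (f (suc zero)))) λ ()

  one-vertex⇒no-path₆ : ¬ HasP6 a
  one-vertex⇒no-path₆ (f , f-inj , _) =
    contradiction (f-inj (one-vertex (f zero) (f (suc zero)))) λ ()

lab1? : ∀ l → Dec (l ≡ lab1)
lab1? lab0 = no λ ()
lab1? lab1 = yes refl
lab1? odot = no λ ()

leaf-no-successor : ∀ {m} {E : Fin m → Fin m → Bool} {v w} → InX E v → E v w ≢ true
leaf-no-successor {v = v} {w} (inj₁ (_ , empty)) e = contradiction (trans (sym (empty v w)) e) λ ()
leaf-no-successor {E = E} {v} (inj₂ (no-out , _))            e = contradiction (subst (1 ≤_) no-out (count-one {p = E v} e)) λ ()

mainTheorem7 : ∀ {n : ℕ} (G : SimpleGraph n) → GaTEx G → Murky G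
mainTheorem7 G (m , E , t , ι , inj₁ (refl , _) , _ , ι-inj , _) =
    one-vertex⇒no-hole adj one , one-vertex⇒no-path₆ adj one
  , one-vertex⇒no-hole (complementAdj adj) one , one-vertex⇒no-path₆ (complementAdj adj) one
  where
  open SimpleGraph G using (adj)

  all-equal : ∀ (x y : Fin 1) → x ≡ y
  all-equal zero zero = refl

  one : ∀ x y → x ≡ y
  one x y = ι-inj (all-equal (ι x) (ι y))
mainTheorem7 G (m , E , t , ι , inj₂ N , _ , ι-inj , ι-onto , adj⇔) =
    explained⇒no-hole E N β ι ι-inj ι-sink adj explained
  , explained⇒no-path₆ E N β ι ι-inj ι-sink adj explained
  , explained⇒no-hole E N (not ∘ β) ι ι-inj ι-sink (complementAdj adj) co-explained
  , explained⇒no-path₆ E N (not ∘ β) ι ι-inj ι-sink (complementAdj adj) co-explained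
  where
  open SimpleGraph G using (adj)

  β : Fin m → Bool
  β v = ⌊ lab1? (t v) ⌋

  ι-sink : ∀ x {w} → Reach E (ι x) w → ι x ≡ w
  ι-sink x here       = refl
  ι-sink x (step e _) = contradiction e (leaf-no-successor (Equivalence.from (ι-onto (ι x)) (x , refl)))

  explained : ∀ {x y} → x ≢ y → ∀ {v} → IsLCA E (ι x) (ι y) v → adj x y ≡ β v
  explained x≢y {v} lca = sym (reflected (lab1? (t v)) (adj⇔ _ _ x≢y v lca))

  co-explained : ∀ {x y} → x ≢ y → ∀ {v} → IsLCA E (ι x) (ι y) v → complementAdj adj x y ≡ not (β v)
  co-explained {x} {y} x≢y lca = trans
    (trans (cong (λ b → not (adj x y) ∧ not b) (fails⇒false (x ≟ y) x≢y)) (Bool.∧-identityʳ _))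
    (cong not (explained x≢y lca))
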